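{- Let $f:\{0,1\}^n\to\{0,1\}$ be a non-constant function, and let $0\le\epsilon<1/4$. Let $\widetilde{\mathrm{avdeg}}^{+,\epsilon}_{\min}(f)$ denote the minimum average degree of a non-negative polynomial that approximates either $f$ or its negation with error at most $\epsilon$. Then $$\mathrm{RC}(f)\ \le\ \frac{2\,\widetilde{\mathrm{avdeg}}^{+,\epsilon}_{\min}(f)-1}{1-4\epsilon}.$$
   Context: Fractional block sensitivity: for $x\in\{0,1\}^n$ and $B\subseteq[n]$, $x^B$ is $x$ with the bits in $B$ flipped; $B$ is a sensitive block of $x$ if $f(x^B)\ne f(x)$. $\mathrm{RC}_x(f)$ is the maximum of $\sum_B a_B$ over non-negative real weights $a_B$ on the sensitive blocks $B$ of $x$ such that $\sum_{B\ni i}a_B\le1$ for every $i\in[n]$ (equivalently, the minimum of $\sum_i c_i$ over non-negative $c_i$ with $\sum_{i\in B}c_i\ge1$ for every sensitive block $B$ of $x$). $\mathrm{RC}(f)=\max_x\mathrm{RC}_x(f)$. Non-negative polynomials: for a partial assignment $p\in\{0,1,*\}^n$ let $|p|$ be its number of non-$*$ entries, write $p\subseteq x$ if $x\in\{0,1\}^n$ agrees with $p$ on all non-$*$ entries, and let $p(x)=\prod_{i:p_i=1}x_i\prod_{i:p_i=0}(1-x_i)$, so that $p(x)=1$ if $p\subseteq x$ and $p(x)=0$ otherwise. A non-negative polynomial is an expression $q=\sum_p w_p\,p(x)$ with non-negative real weights $w_p$. Its average degree is $\max_{x\in\{0,1\}^n}\sum_{p:\,p\subseteq x}w_p|p|$.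 A polynomial $q$ approximates $g:\{0,1\}^n\to\{0,1\}$ with error at most $\epsilon$ if $q(x)\in[0,\epsilon]$ for all $x\in g^{ -1}(0)$ and $q(x)\in[1-\epsilon,1]$ for all $x\in g^{ -1}(1)$. The negation of $f$ is $1-f$. -}

module Defs where

open import Algebra.Apartness.Bundles using (HeytingField)
open import Algebra.Bundles using (CommutativeRing)
import Algebra.Apartness.Properties.HeytingCommutativeRing as HeytingProperties
import Algebra.Properties.Semiring.Mult as Mult
open import Data.Bool.Base using (Bool; true; false; not; _xor_)
open import Data.Bool.Properties using (_≟_)
open import Data.Fin.Subset using (Subset)
open import Data.Fin.Subset.Properties using (_∈?_)
open import Data.List.Base using (List; []; _∷_; [_]; foldr; map; filter; cartesianProductWith)
open import Data.Maybe.Base using (Maybe; just; nothing; is-just)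
import Data.Maybe.Relation.Unary.All as Maybe
open import Data.Nat.Base using (ℕ; zero; suc) renaming (_≤_ to _≤ℕ_)
open import Data.Product.Base using (∃-syntax; ∃₂; _×_; _,_; proj₁; proj₂)
open import Data.Sum.Base using (_⊎_)
open import Data.Vec.Base using (Vec; []; _∷_; zipWith; foldr′; countᵇ)
open import Data.Vec.Relation.Binary.Pointwise.Inductive using (Pointwise; decidable)
open import Function.Base using (_∘_)
open import Level using (Level; _⊔_) renaming (suc to lsuc)
open import Relation.Binary.Core using (Rel)
open import Relation.Binary.Structures using (IsStrictPartialOrder)
open import Relation.Binary.PropositionalEquality.Core using (_≡_; _≢_)
open import Relation.Nullary.Decidable using (Dec; ¬?)
open import Relation.Nullary.Negation using (¬_)
open import Relation.Unary using (Pred)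

-- The real numbers, axiomatised as a Cauchy-complete Archimedean ordered
-- field.  The axioms are those of Geuvers and Niqui ("Constructive reals in
-- Coq: axioms and categoricity"): any two models are isomorphic, and the Cauchy
-- reals are a model without any classical axiom.

record RealNumbers c ℓ₁ ℓ₂ : Set (lsuc (c ⊔ ℓ₁ ⊔ ℓ₂)) where
  field
    heytingField : HeytingField c ℓ₁ ℓ₂

  open HeytingField heytingField public

  infix 4 _<_ _≤_

  field
    _<_                  : Rel Carrier ℓ₂
    isStrictPartialOrder : IsStrictPartialOrder _≈_ _<_
    #⇒<⊎>                : ∀ {x y} → x # y → x < y ⊎ y < x
    <⇒#                  : ∀ {x y} → x < y → x # y
    0<1                  : 0# < 1#
    +-monoˡ-<            : ∀ z {x y} → x < y → x + z < y + z
    *-pos                : ∀ {x y} → 0# < x → 0# < y → 0# < x * y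

  open IsStrictPartialOrder isStrictPartialOrder public
    using (<-respˡ-≈; <-respʳ-≈)
    renaming (trans to <-trans; irrefl to <-irrefl; asym to <-asym)

  commutativeRing : CommutativeRing c ℓ₁
  commutativeRing = record { isCommutativeRing = isCommutativeRing }

  open CommutativeRing commutativeRing public using (semiring)

  -- n · x is the n-fold sum x + … + x.
  open Mult semiring public using (×-comm-*) renaming (_×_ to infixr 8 _·_)

  -- For a tight cotransitive order this is the usual non-strict order.
  _≤_ : Rel Carrier ℓ₂
  x ≤ y = ¬ (y < x)

  Close : Carrier → Carrier → Carrier → Set ℓ₂
  Close δ x y = (x - y < δ) × (y - x < δ)

  IsCauchy : (ℕ → Carrier) → Set (c ⊔ ℓ₂)
  IsCauchy s = ∀ δ → 0# < δ → ∃[ N ] ∀ m → N ≤ℕ m → Close δ (s m) (s N)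

  ConvergesTo : (ℕ → Carrier) → Carrier → Set (c ⊔ ℓ₂)
  ConvergesTo s l = ∀ δ → 0# < δ → ∃[ N ] ∀ m → N ≤ℕ m → Close δ (s m) l

  field
    archimedean : ∀ x → ∃[ n ] x < n · 1#
    complete    : ∀ s → IsCauchy s → ∃[ l ] ConvergesTo s l

module RealProperties {c ℓ₁ ℓ₂} (R : RealNumbers c ℓ₁ ℓ₂) where
  open RealNumbers R
  open HeytingProperties (HeytingField.heytingCommutativeRing heytingField)
    using (x-0≈x)

  0<⇒#0 : ∀ {x} → 0# < x → x # 0#
  0<⇒#0 0<x = #-sym (<⇒# 0<x)

  infixl 7 _÷_[_]

  _÷_[_] : ∀ x y → y # 0# → Carrier
  x ÷ y [ y#0 ] = x * proj₁ (#⇒invertible y#0)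

  y*x÷y≈x : ∀ x y (y#0 : y # 0#) → y * (x ÷ y [ y#0 ]) ≈ x
  y*x÷y≈x x y y#0 = trans (*-comm y _) (trans (*-assoc x _ y)
    (trans (*-congˡ (trans (*-congˡ (sym (x-0≈x y))) (proj₁ (proj₂ (#⇒invertible y#0)))))
           (*-identityʳ x)))

  +-mono-< : ∀ {x y u v} → x < y → u < v → x + u < y + v
  +-mono-< {y = y} {u} x<y u<v = <-trans (+-monoˡ-< u x<y)
    (<-respˡ-≈ (+-comm u y) (<-respʳ-≈ (+-comm _ y) (+-monoˡ-< y u<v)))

  ·-monoʳ-< : ∀ n {x y} → x < y → suc n · x < suc n · y
  ·-monoʳ-< zero    x<y = +-monoˡ-< 0# x<y
  ·-monoʳ-< (suc n) x<y = +-mono-< x<y (·-monoʳ-< n x<y)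

  ·0≈0 : ∀ n → n · 0# ≈ 0#
  ·0≈0 zero    = refl
  ·0≈0 (suc n) = trans (+-identityˡ _) (·0≈0 n)

  0<4 : 0# < 4 · 1#
  0<4 = <-respˡ-≈ (·0≈0 4) (·-monoʳ-< 3 0<1)

  ¼ : Carrier
  ¼ = 1# ÷ 4 · 1# [ 0<⇒#0 0<4 ]

  4·¼≈1 : 4 · ¼ ≈ 1#
  4·¼≈1 = trans (sym 4·1*¼≈4·¼) (y*x÷y≈x 1# (4 · 1#) (0<⇒#0 0<4))
    where
    4·1*¼≈4·¼ : (4 · 1#) * ¼ ≈ 4 · ¼
    4·1*¼≈4·¼ = trans (*-comm _ ¼) (trans (×-comm-* 4 ¼ 1#)
      (Mult.×-congʳ semiring 4 (*-identityʳ ¼)))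

  0<1-4ε : ∀ {ε} → ε < ¼ → 0# < 1# - 4 · ε
  0<1-4ε {ε} ε<¼ = <-respˡ-≈ (-‿inverseʳ (4 · ε))
    (+-monoˡ-< (- (4 · ε)) (<-respʳ-≈ 4·¼≈1 (·-monoʳ-< 3 ε<¼)))

  1-4ε#0 : ∀ {ε} → ε < ¼ → 1# - 4 · ε # 0#
  1-4ε#0 = 0<⇒#0 ∘ 0<1-4ε

  ∑ : ∀ {a} {A : Set a} → List A → (A → Carrier) → Carrier
  ∑ xs g = foldr _+_ 0# (map g xs)

  IsMaximumOf IsMinimumOf : ∀ {ℓ} → Pred Carrier ℓ → Pred Carrier (c ⊔ ℓ₂ ⊔ ℓ)
  IsMaximumOf P m = P m × (∀ {s} → P s → s ≤ m)
  IsMinimumOf P m = P m × (∀ {s} → P s → m ≤ s)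

BooleanFunction : ℕ → Set
BooleanFunction n = Vec Bool n → Bool

NonConstant : ∀ {n} → BooleanFunction n → Set
NonConstant f = ∃₂ λ x y → f x ≢ f y

-- Each vector over the given alphabet, listed exactly once when the alphabet
-- has no repetitions.
vectors : ∀ {a} {A : Set a} → List A → ∀ n → List (Vec A n)
vectors as zero    = [ [] ]
vectors as (suc n) = cartesianProductWith _∷_ as (vectors as n)

subsets : ∀ n → List (Subset n)
subsets = vectors (false ∷ true ∷ [])

infixl 8 _^_

_^_ : ∀ {n} → Vec Bool n → Subset n → Vec Bool n
_^_ = zipWith _xor_

module _ {n} (f : BooleanFunction n) (x : Vec Bool n) where

  Sensitive : Subset n → Set
  Sensitive B = f (x ^ B) ≢ f x

  sensitive? : ∀ B → Dec (Sensitive B)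
  sensitive? B = ¬? (f (x ^ B) ≟ f x)

  sensitiveBlocks : List (Subset n)
  sensitiveBlocks = filter sensitive? (subsets n)

-- nothing plays the role of *.
PartialAssignment : ℕ → Set
PartialAssignment = Vec (Maybe Bool)

partialAssignments : ∀ n → List (PartialAssignment n)
partialAssignments = vectors (nothing ∷ just false ∷ just true ∷ [])

∣_∣ : ∀ {n} → PartialAssignment n → ℕ
∣_∣ = countᵇ is-just

infix 4 _⊆_ _⊆?_

_⊆_ : ∀ {n} → PartialAssignment n → Vec Bool n → Set
_⊆_ = Pointwise (λ pᵢ xᵢ → Maybe.All (_≡ xᵢ) pᵢ)

_⊆?_ : ∀ {n} (p : PartialAssignment n) (x : Vec Bool n) → Dec (p ⊆ x)
_⊆?_ = decidable (λ pᵢ xᵢ → Maybe.dec (_≟ xᵢ) pᵢ)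

module BooleanComplexity {c ℓ₁ ℓ₂} (R : RealNumbers c ℓ₁ ℓ₂) where
  open RealNumbers R public
  open RealProperties R public

  -- Only the values of a on sensitive blocks matter.
  IsFractionalPacking : ∀ {n} → BooleanFunction n → Vec Bool n → (Subset n → Carrier) → Set ℓ₂
  IsFractionalPacking {n} f x a =
    (∀ B → Sensitive f x B → 0# ≤ a B) ×
    (∀ i → ∑ (filter (i ∈?_) (sensitiveBlocks f x)) a ≤ 1#)

  IsRCAt : ∀ {n} → BooleanFunction n → Vec Bool n → Carrier → Set (c ⊔ ℓ₁ ⊔ ℓ₂)
  IsRCAt f x = IsMaximumOf λ s →
    ∃[ a ] IsFractionalPacking f x a × s ≈ ∑ (sensitiveBlocks f x) a

  IsRC : ∀ {n} → BooleanFunction n → Carrier → Set (c ⊔ ℓ₁ ⊔ ℓ₂)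
  IsRC f = IsMaximumOf λ s → ∃[ x ] IsRCAt f x s

  bit : Bool → Carrier
  bit false = 0#
  bit true  = 1#

  literal : Maybe Bool → Bool → Carrier
  literal nothing      xᵢ = 1#
  literal (just true)  xᵢ = bit xᵢ
  literal (just false) xᵢ = 1# - bit xᵢ

  monomial : ∀ {n} → PartialAssignment n → Vec Bool n → Carrier
  monomial p x = foldr′ _*_ 1# (zipWith literal p x)

  record NonNegPolynomial (n : ℕ) : Set (c ⊔ ℓ₂) where
    field
      weight   : PartialAssignment n → Carrier
      weight≥0 : ∀ p → 0# ≤ weight p

  open NonNegPolynomial public

  eval : ∀ {n} → NonNegPolynomial n → Vec Bool n → Carrier
  eval {n} q x = ∑ (partialAssignments n) λ p → weight q p * monomial p x

  degreeAt : ∀ {n} → NonNegPolynomial n → Vec Bool n → Carrier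
  degreeAt {n} q x = ∑ (filter (_⊆? x) (partialAssignments n)) λ p → weight q p * (∣ p ∣ · 1#)

  IsAverageDegree : ∀ {n} → NonNegPolynomial n → Carrier → Set (c ⊔ ℓ₁ ⊔ ℓ₂)
  IsAverageDegree q = IsMaximumOf λ s → ∃[ x ] s ≈ degreeAt q x

  Approximates : ∀ {n} → Carrier → NonNegPolynomial n → BooleanFunction n → Set ℓ₂
  Approximates ε q g = ∀ x →
    (g x ≡ false → 0# ≤ eval q x × eval q x ≤ ε) ×
    (g x ≡ true  → 1# - ε ≤ eval q x × eval q x ≤ 1#)

  IsMinAverageDegree : ∀ {n} → Carrier → BooleanFunction n → Carrier → Set (c ⊔ ℓ₁ ⊔ ℓ₂)
  IsMinAverageDegree ε f = IsMinimumOf λ s →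
    ∃[ q ] (Approximates ε q f ⊎ Approximates ε q (not ∘ f)) × IsAverageDegree q s

{-# OPTIONS --safe #-}

-- Let q = ∑ₚ wₚ p approximate f, let a be a fractional packing of total weight s
-- on sensitive blocks of x, and let d bound the degrees of q.
--
-- If f x = 1, then for each block B the p ⊆ x meeting B have weight at least
-- 1 - 2ε.  Since ∑ { a B ∣ B meets p } ≤ ∣ p ∣, this gives
-- s (1 - 2ε) ≤ d, which suffices as soon as s ≥ 1.
--
-- If f x = 0, consider pairs of blocks B, C.  A p that agrees with x ^ B either
-- agrees with x ^ (B ∪ C) or meets C ∖ B, so q (x ^ (B ∪ C)) ≤ 1 forces the p ⊆ x ^ B
-- meeting C ∖ B, the p ⊆ x ^ C meeting B ∖ C and the p that agree with both x ^ B
-- and x ^ C to have total weight at least 1 - 2ε.  Averaging over B and C with weights a and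
-- using that a p ⊆ x ^ B with p ⊈ x fixes a coordinate in B yields
-- s ≤ 2d - 1 + (3s + 2) ε, which suffices as soon as s ≥ 2.
--
-- The claim s (1 - 4ε) ≤ 2d - 1 for one packing implies it for all lighter ones.  So
-- for s < 2, take a sensitive edge of the cube, in direction i.  Either one of its
-- endpoints has a sensitive block avoiding i, which together with { i } is a packing of
-- weight 2, or f depends on coordinate i only and s ≤ 1, while { i } is a packing of
-- weight 1 at the endpoint where f is 1.
module Submission where

open import Defs
open import Algebra.Bundles using (CommutativeRing)
import Algebra.Solver.Ring.NaturalCoefficients.Default as NaturalSolver
open import Data.Bool.Base using (Bool; true; false; not; _xor_)
import Data.Bool.Properties as Bool
open import Data.Empty using (⊥-elim)
open import Data.Fin.Base using (Fin; zero; suc)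
open import Data.Fin.Subset using (Subset; _∈_; _∉_; _∪_; ⁅_⁆) renaming (⊥ to ∅)
open import Data.Fin.Subset.Properties
  using (_∈?_; x∈⁅x⁆; x∈⁅y⁆⇒x≡y; anySubset?; ∪-identityˡ; ∪-comm)
open import Data.List.Base using (List; []; _∷_; map; length; filter)
open import Data.List.Properties using (length-map; filter-all)
open import Data.List.Relation.Unary.All as All using (All; []; _∷_)
import Data.List.Relation.Unary.All.Properties as All
open import Data.List.Relation.Unary.Any as Any using (Any; here; there)
import Data.List.Relation.Unary.Any.Properties as Any
open import Data.Maybe.Base using (just; nothing)
import Data.Maybe.Relation.Unary.All as Maybe
open import Data.Nat.Base as ℕ using (ℕ; zero; suc; s≤s; z≤n) renaming (_≤_ to _≤ℕ_; _<_ to _<ℕ_)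
import Data.Nat.Properties as ℕ
open import Data.Product.Base using (∃-syntax; _×_; _,_; proj₁; proj₂)
open import Data.Sum.Base using (_⊎_; inj₁; inj₂; [_,_])
open import Data.Vec.Base using (Vec; []; _∷_; lookup; here; there)
open import Data.Vec.Properties using (zipWith-identityʳ)
open import Data.Vec.Relation.Binary.Pointwise.Inductive using ([]; _∷_)
open import Function.Base using (_∘_; id)
open import Level using (Level)
open import Relation.Binary.Bundles using (Preorder)
import Relation.Binary.PropositionalEquality as ≡
open ≡ using (_≡_; _≢_)
import Relation.Binary.Reasoning.Preorder as PreorderReasoning
open import Relation.Nullary.Decidable using (Dec; yes; no; does; ¬?; _×-dec_)
open import Relation.Nullary.Negation using (¬_)
open import Relation.Unary using (Pred; Decidable)

-- Partial assignments and flipped blocks.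

private
  variable
    n : ℕ

-- A list rather than a subset, so that a union bound over these coordinates runs by induction and
-- yields its length.
supportOutside : PartialAssignment n → Subset n → List (Fin n)
supportOutside []            []          = []
supportOutside (nothing ∷ p) (_     ∷ B) = map suc (supportOutside p B)
supportOutside (just _  ∷ p) (true  ∷ B) = map suc (supportOutside p B)
supportOutside (just _  ∷ p) (false ∷ B) = zero ∷ map suc (supportOutside p B)

private
  length-shifted : ∀ k (p : PartialAssignment n) B {m} → k ℕ.+ length (supportOutside p B) ≤ℕ m →
                   k ℕ.+ length (map Fin.suc (supportOutside p B)) ≤ℕ m
  length-shifted k p B {m} =
    ≡.subst (λ l → k ℕ.+ l ≤ℕ m) (≡.sym (length-map Fin.suc (supportOutside p B)))

length-supportOutside : ∀ (p : PartialAssignment n) B → length (supportOutside p B) ≤ℕ ∣ p ∣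
length-supportOutside []            []          = ℕ.≤-refl
length-supportOutside (nothing ∷ p) (_     ∷ B) =
  length-shifted 0 p B (length-supportOutside p B)
length-supportOutside (just _  ∷ p) (true  ∷ B) =
  length-shifted 0 p B (ℕ.m≤n⇒m≤1+n (length-supportOutside p B))
length-supportOutside (just _  ∷ p) (false ∷ B) =
  length-shifted 1 p B (s≤s (length-supportOutside p B))

-- The coordinate `i` counts in `∣ p ∣` but is left out of the list. Used twice when `f x` is false,
-- this saving of one pays for the intersection term and for the final `- 1#`.
length-supportOutside-< : ∀ (p : PartialAssignment n) {B i b} → lookup p i ≡ just b → i ∈ B →
                          length (supportOutside p B) <ℕ ∣ p ∣
length-supportOutside-< (just _ ∷ p)  {B = true  ∷ B} _  here        =
  length-shifted 1 p B (s≤s (length-supportOutside p B))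
length-supportOutside-< (nothing ∷ p) {B = _     ∷ B} pᵢ (there i∈B) =
  length-shifted 1 p B (length-supportOutside-< p pᵢ i∈B)
length-supportOutside-< (just _ ∷ p)  {B = true  ∷ B} pᵢ (there i∈B) =
  length-shifted 1 p B (ℕ.m≤n⇒m≤1+n (length-supportOutside-< p pᵢ i∈B))
length-supportOutside-< (just _ ∷ p)  {B = false ∷ B} pᵢ (there i∈B) =
  length-shifted 2 p B (s≤s (length-supportOutside-< p pᵢ i∈B))

-- p fixes a coordinate in C ∖ B.
Touches : PartialAssignment n → Subset n → Subset n → Set
Touches p B C = Any (_∈ C) (supportOutside p B)

touches? : ∀ (p : PartialAssignment n) B C → Dec (Touches p B C)
touches? p B C = Any.any? (_∈? C) (supportOutside p B)

private
  tail-¬touches : ∀ {c} {C : Subset n} {is} → ¬ Any (_∈ (c ∷ C)) (map suc is) → ¬ Any (_∈ C) is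
  tail-¬touches ¬t = ¬t ∘ Any.map⁺ ∘ Any.map there

-- The points `x ^ B` and `x ^ (B ∪ C)` differ only on the part of `C` outside `B`, where `p` fixes
-- nothing.
⊆-^∪ˡ : ∀ (p : PartialAssignment n) x B C →
        p ⊆ x ^ B → ¬ Touches p B C → p ⊆ x ^ (B ∪ C)
⊆-^∪ˡ [] [] [] [] p⊆ ¬t = []
⊆-^∪ˡ (nothing ∷ p) (_ ∷ x) (_ ∷ B) (_ ∷ C) (_ ∷ p⊆) ¬t =
  Maybe.nothing ∷ ⊆-^∪ˡ p x B C p⊆ (tail-¬touches ¬t)
⊆-^∪ˡ (just _ ∷ p) (_ ∷ x) (true ∷ B) (_ ∷ C) (h ∷ p⊆) ¬t =
  h ∷ ⊆-^∪ˡ p x B C p⊆ (tail-¬touches ¬t)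
⊆-^∪ˡ (just _ ∷ p) (_ ∷ x) (false ∷ B) (true ∷ C) (h ∷ p⊆) ¬t = ⊥-elim (¬t (here here))
⊆-^∪ˡ (just _ ∷ p) (_ ∷ x) (false ∷ B) (false ∷ C) (h ∷ p⊆) ¬t =
  h ∷ ⊆-^∪ˡ p x B C p⊆ (tail-¬touches (¬t ∘ there))

-- Each bit of `x ^ (B ∪ C)` comes from `x ^ B` on `B` and from `x ^ C` elsewhere.
⊆-^∪ : ∀ (p : PartialAssignment n) x B C → p ⊆ x ^ B → p ⊆ x ^ C → p ⊆ x ^ (B ∪ C)
⊆-^∪ [] [] [] [] [] [] = []
⊆-^∪ (_ ∷ p) (_ ∷ x) (true  ∷ B) (_ ∷ C) (h ∷ p⊆B) (_ ∷ p⊆C) = h ∷ ⊆-^∪ p x B C p⊆B p⊆C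
⊆-^∪ (_ ∷ p) (_ ∷ x) (false ∷ B) (_ ∷ C) (_ ∷ p⊆B) (h ∷ p⊆C) = h ∷ ⊆-^∪ p x B C p⊆B p⊆C

^-∅ : ∀ (x : Vec Bool n) → x ^ ∅ ≡ x
^-∅ = zipWith-identityʳ Bool.xor-identityʳ

⊈⇒conflict : ∀ (p : PartialAssignment n) x → ¬ p ⊆ x →
             ∃[ i ] lookup p i ≡ just (not (lookup x i))
⊈⇒conflict []            []      p⊈x = ⊥-elim (p⊈x [])
⊈⇒conflict (nothing ∷ p) (b ∷ x) p⊈x =
  let i , pᵢ = ⊈⇒conflict p x (p⊈x ∘ (Maybe.nothing ∷_)) in suc i , pᵢ
⊈⇒conflict (just a ∷ p)  (b ∷ x) p⊈x with a Bool.≟ b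
... | yes ≡.refl = let i , pᵢ = ⊈⇒conflict p x (p⊈x ∘ (Maybe.just ≡.refl ∷_)) in suc i , pᵢ
... | no  a≢b  = zero , ≡.cong just (Bool.¬-not a≢b)

-- A flip that makes the point agree with `p` must change bit `i`. All such `C` share `i`, so the
-- packing constraint at `i` bounds their total weight by 1.
conflict⇒∈ : ∀ (p : PartialAssignment n) x C i →
             lookup p i ≡ just (not (lookup x i)) → p ⊆ x ^ C → i ∈ C
conflict⇒∈ (_ ∷ p) (b ∷ x) (true ∷ C) zero pᵢ _ = here
conflict⇒∈ (_ ∷ p) (b ∷ x) (false ∷ C) zero ≡.refl (Maybe.just ¬b≡b ∷ _) =
  ⊥-elim (Bool.not-¬ ≡.refl (≡.sym (≡.trans ¬b≡b (Bool.xor-identityʳ b))))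
conflict⇒∈ (_ ∷ p) (_ ∷ x) (_ ∷ C) (suc i) pᵢ (_ ∷ p⊆) = there (conflict⇒∈ p x C i pᵢ p⊆)

-- Differences of points, sensitive edges and dictators.

^-involutive : ∀ (x : Vec Bool n) B → x ^ B ^ B ≡ x
^-involutive []      []      = ≡.refl
^-involutive (b ∷ x) (c ∷ B) = ≡.cong₂ _∷_ (≡.trans (Bool.xor-assoc b c c)
  (≡.trans (≡.cong (b xor_) (Bool.xor-same c)) (Bool.xor-identityʳ b))) (^-involutive x B)

-- As points and subsets are both bit vectors, x ^ y is the set where x and y differ.
^-difference : ∀ (x y : Vec Bool n) → x ^ (x ^ y) ≡ y
^-difference []      []      = ≡.refl
^-difference (b ∷ x) (c ∷ y) = ≡.cong₂ _∷_
  (≡.trans (≡.sym (Bool.xor-assoc b b c)) (≡.cong (_xor c) (Bool.xor-same b))) (^-difference x y)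

∈⇒^-flips : ∀ (x : Vec Bool n) {B i} → i ∈ B → lookup (x ^ B) i ≡ not (lookup x i)
∈⇒^-flips (b ∷ x) here        = Bool.xor-comm b true
∈⇒^-flips (b ∷ x) (there i∈B) = ∈⇒^-flips x i∈B

∉⇒^-fixes : ∀ (x : Vec Bool n) B {i} → i ∉ B → lookup (x ^ B) i ≡ lookup x i
∉⇒^-fixes (b ∷ x) (true  ∷ B) {zero}  i∉B = ⊥-elim (i∉B here)
∉⇒^-fixes (b ∷ x) (false ∷ B) {zero}  i∉B = Bool.xor-identityʳ b
∉⇒^-fixes (b ∷ x) (_ ∷ B)     {suc i} i∉B = ∉⇒^-fixes x B (i∉B ∘ there)

-- Walk from one point to the other, correcting one bit at a time from the front: some step must
-- change the value of `f`.
sensitiveEdge : (f : BooleanFunction n) → NonConstant f → ∃[ u ] ∃[ i ] Sensitive f u ⁅ i ⁆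
sensitiveEdge f ([]    , []    , fx≢fy) = ⊥-elim (fx≢fy ≡.refl)
sensitiveEdge f (a ∷ x , b ∷ y , fx≢fy) with f (a ∷ x) Bool.≟ f (b ∷ x)
... | yes fx≡ with sensitiveEdge (f ∘ (b ∷_)) (x , y , fx≢fy ∘ ≡.trans fx≡)
...   | u , i , s = b ∷ u , suc i ,
        ≡.subst (λ b′ → f (b′ ∷ _) ≢ f (b ∷ u)) (≡.sym (Bool.xor-identityʳ b)) s
sensitiveEdge f (a ∷ x , b ∷ y , fx≢fy) | no fx≢ =
  a ∷ x , zero , λ eq → fx≢ (≡.trans (≡.sym eq)
    (≡.cong f (≡.cong₂ _∷_ flip (^-∅ x))))
  where
  flip : a xor true ≡ b
  flip = ≡.trans (Bool.xor-comm a true)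
    (≡.sym (Bool.¬-not (λ b≡a → fx≢ (≡.cong (f ∘ (_∷ x)) (≡.sym b≡a)))))

sensitive-^ : (f : BooleanFunction n) → ∀ x B → Sensitive f x B → Sensitive f (x ^ B) B
sensitive-^ f x B s = ≡.subst (λ y → f y ≢ f (x ^ B)) (≡.sym (^-involutive x B)) (≡.≢-sym s)

HasDisjointSensitiveBlocks : BooleanFunction n → Set
HasDisjointSensitiveBlocks f =
  ∃[ u ] ∃[ i ] ∃[ C ] Sensitive f u ⁅ i ⁆ × Sensitive f u C × i ∉ C

-- Says that `f` depends on no coordinate but `i`. In this form the packing constraint at `i` bounds
-- an entire packing.
Dictator : BooleanFunction n → Fin n → Set
Dictator f i = ∀ x B → Sensitive f x B → i ∈ B

-- The endpoints `u` and `u ^ ⁅ i ⁆` carry the two values of bit `i`. If neither has a sensitive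
-- block avoiding `i`, then `f` is constant on each of the two half-cubes.
disjointOrDictator : (f : BooleanFunction n) → ∀ u i → Sensitive f u ⁅ i ⁆ →
                     HasDisjointSensitiveBlocks f ⊎ Dictator f i
disjointOrDictator f u i s with anySubset? (λ C → sensitive? f u C ×-dec ¬? (i ∈? C))
... | yes (C , sC , i∉C) = inj₁ (u , i , C , s , sC , i∉C)
... | no noC with anySubset? (λ C → sensitive? f (u ^ ⁅ i ⁆) C ×-dec ¬? (i ∈? C))
...   | yes (C , sC , i∉C) = inj₁ (u ^ ⁅ i ⁆ , i , C , sensitive-^ f u ⁅ i ⁆ s , sC , i∉C)
...   | no noC′ = inj₂ dictator
  where
  v = u ^ ⁅ i ⁆

  -- The block `z ^ y` turns `z` into `y` and avoids `i`, so a change of value would make it one of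
  -- the excluded blocks.
  constant-on : ∀ z → ¬ (∃[ C ] Sensitive f z C × i ∉ C) →
                ∀ y → lookup y i ≡ lookup z i → f y ≡ f z
  constant-on z none y yᵢ≡zᵢ with f y Bool.≟ f z
  ... | yes fy≡fz = fy≡fz
  ... | no  fy≢fz = ⊥-elim (none (z ^ y , ≡.subst (λ y → f y ≢ f z) (≡.sym (^-difference z y)) fy≢fz ,
    λ i∈ → Bool.not-¬ ≡.refl (≡.trans (≡.sym yᵢ≡zᵢ)
      (≡.trans (≡.cong (λ w → lookup w i) (≡.sym (^-difference z y))) (∈⇒^-flips z i∈)))))

  sameBit : ∀ x y → lookup x i ≡ lookup y i → f x ≡ f y
  sameBit x y xᵢ≡yᵢ with lookup y i Bool.≟ lookup u i
  ... | yes yᵢ≡uᵢ = ≡.trans (constant-on u noC x (≡.trans xᵢ≡yᵢ yᵢ≡uᵢ)) (≡.sym (constant-on u noC y yᵢ≡uᵢ))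
  ... | no  yᵢ≢uᵢ = ≡.trans (constant-on v noC′ x (≡.trans xᵢ≡yᵢ yᵢ≡vᵢ)) (≡.sym (constant-on v noC′ y yᵢ≡vᵢ))
    where
    yᵢ≡vᵢ : lookup y i ≡ lookup v i
    yᵢ≡vᵢ = ≡.trans (Bool.¬-not yᵢ≢uᵢ) (≡.sym (∈⇒^-flips u (x∈⁅x⁆ i)))

  dictator : Dictator f i
  dictator x B sB with i ∈? B
  ... | yes i∈B = i∈B
  ... | no  i∉B = ⊥-elim (sB (sameBit (x ^ B) x (∉⇒^-fixes x B i∉B)))

-- Order arithmetic without decidability.

module OrderedField {c ℓ₁ ℓ₂} (ℝ : RealNumbers c ℓ₁ ℓ₂) where
  open RealNumbers ℝ
  open CommutativeRing commutativeRing public using (commutativeSemiring)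
  open NaturalSolver commutativeSemiring using (solve; con; _:+_; _:*_; _:=_)

  <⇒≤ : ∀ {x y} → x < y → x ≤ y
  <⇒≤ = <-asym

  ≤-reflexive : ∀ {x y} → x ≈ y → x ≤ y
  ≤-reflexive x≈y = <-irrefl (sym x≈y)

  ≤-trans : ∀ {x y z} → x ≤ y → y ≤ z → x ≤ z
  ≤-trans {x} {y} {z} x≤y y≤z z<x with #-cotrans (<⇒# z<x) y
  ... | inj₁ z#y = [ y≤z , (λ y<z → x≤y (<-trans y<z z<x)) ] (#⇒<⊎> z#y)
  ... | inj₂ y#x = [ x≤y , (λ x<y → y≤z (<-trans z<x x<y)) ] (#⇒<⊎> y#x)

  preorder : Preorder c ℓ₁ ℓ₂
  preorder = record
    { _≲_ = _≤_
    ; isPreorder = record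
      { isEquivalence = isEquivalence ; reflexive = ≤-reflexive ; trans = ≤-trans } }

  module ≤-Reasoning = PreorderReasoning preorder
  open ≤-Reasoning

  ≤-refl : ∀ {x} → x ≤ x
  ≤-refl = ≤-reflexive refl

  ≤-respˡ : ∀ {x y z} → x ≈ y → x ≤ z → y ≤ z
  ≤-respˡ x≈y = ≤-trans (≤-reflexive (sym x≈y))

  ≤-respʳ : ∀ {x y z} → y ≈ z → x ≤ y → x ≤ z
  ≤-respʳ y≈z x≤y = ≤-trans x≤y (≤-reflexive y≈z)

  x+y-y≈x : ∀ x y → x + y - y ≈ x
  x+y-y≈x x y = trans (+-assoc x y (- y)) (trans (+-congˡ (-‿inverseʳ y)) (+-identityʳ x))

  x-y+y≈x : ∀ x y → x - y + y ≈ x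
  x-y+y≈x x y = trans (+-assoc x (- y) y) (trans (+-congˡ (-‿inverseˡ y)) (+-identityʳ x))

  +-cancelʳ-< : ∀ z {x y} → x + z < y + z → x < y
  +-cancelʳ-< z {x} {y} =
    <-respˡ-≈ (x+y-y≈x x z) ∘ <-respʳ-≈ (x+y-y≈x y z) ∘ +-monoˡ-< (- z)

  +-cancelʳ-≤ : ∀ z {x y} → x + z ≤ y + z → x ≤ y
  +-cancelʳ-≤ z x+z≤y+z = x+z≤y+z ∘ +-monoˡ-< z

  +-monoˡ-≤ : ∀ z {x y} → x ≤ y → x + z ≤ y + z
  +-monoˡ-≤ z x≤y = x≤y ∘ +-cancelʳ-< z

  +-monoʳ-≤ : ∀ z {x y} → x ≤ y → z + x ≤ z + y
  +-monoʳ-≤ z {x} {y} x≤y = ≤-respˡ (+-comm x z) (≤-respʳ (+-comm y z) (+-monoˡ-≤ z x≤y))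

  +-mono-≤ : ∀ {x y u v} → x ≤ y → u ≤ v → x + u ≤ y + v
  +-mono-≤ {y = y} {u} x≤y u≤v = ≤-trans (+-monoˡ-≤ u x≤y) (+-monoʳ-≤ y u≤v)

  *-monoʳ-< : ∀ z {x y} → 0# < z → x < y → z * x < z * y
  *-monoʳ-< z {x} {y} 0<z x<y =
    <-respˡ-≈ (+-identityˡ (z * x)) (<-respʳ-≈ difference
      (+-monoˡ-< (z * x) (*-pos 0<z (<-respˡ-≈ (-‿inverseʳ x) (+-monoˡ-< (- x) x<y)))))
    where
    difference : z * (y - x) + z * x ≈ z * y
    difference = trans (sym (distribˡ z (y - x) x)) (*-congˡ (x-y+y≈x y x))

  *-cancelˡ-≤ : ∀ z {x y} → 0# < z → z * x ≤ z * y → x ≤ y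
  *-cancelˡ-≤ z 0<z zx≤zy = zx≤zy ∘ *-monoʳ-< z 0<z

  ≤⇒¬¬< : ∀ {x y} → x ≤ y → ¬ (x ≈ y) → ¬ ¬ (x < y)
  ≤⇒¬¬< {x} {y} x≤y x≉y x≮y = x≉y (proj₁ (tight x y) λ x#y → [ x≮y , x≤y ] (#⇒<⊎> x#y))

  -- The goal is a negation, so strict forms of both hypotheses may be assumed: equality in either
  -- would make the two products equal.
  *-monoʳ-≤ : ∀ z {x y} → 0# ≤ z → x ≤ y → z * x ≤ z * y
  *-monoʳ-≤ z {x} {y} 0≤z x≤y zy<zx = ≤⇒¬¬< 0≤z 0≉z λ 0<z → ≤⇒¬¬< x≤y x≉y λ x<y →
      <-asym zy<zx (*-monoʳ-< z 0<z x<y)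
    where
    0≉z : ¬ (0# ≈ z)
    0≉z 0≈z = <-irrefl (trans (*-congʳ (sym 0≈z)) (trans (zeroˡ y) (trans (sym (zeroˡ x)) (*-congʳ 0≈z)))) zy<zx
    x≉y : ¬ (x ≈ y)
    x≉y x≈y = <-irrefl (*-congˡ (sym x≈y)) zy<zx

  *-nonNeg : ∀ {x y} → 0# ≤ x → 0# ≤ y → 0# ≤ x * y
  *-nonNeg {x} 0≤x 0≤y = ≤-respˡ (zeroʳ x) (*-monoʳ-≤ x 0≤x 0≤y)

  +-nonNeg : ∀ {x y} → 0# ≤ x → 0# ≤ y → 0# ≤ x + y
  +-nonNeg 0≤x 0≤y = ≤-respˡ (+-identityˡ 0#) (+-mono-≤ 0≤x 0≤y)

  x≤x+y : ∀ x {y} → 0# ≤ y → x ≤ x + y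
  x≤x+y x 0≤y = ≤-respˡ (+-identityʳ x) (+-monoʳ-≤ x 0≤y)

  y≤x+y : ∀ {x} y → 0# ≤ x → y ≤ x + y
  y≤x+y {x} y 0≤x = ≤-respʳ (+-comm y x) (x≤x+y y 0≤x)

  -- As u ≤ v is the negation of v < u, its proof may split on an undecidable order relation.
  ≤-by-cases : ∀ x y {u v} → (x < y → u ≤ v) → (y ≤ x → u ≤ v) → u ≤ v
  ≤-by-cases x y lt ge v<u = ge (λ x<y → lt x<y v<u) v<u

  0≤1 : 0# ≤ 1#
  0≤1 = <⇒≤ 0<1

  0≤n·1 : ∀ n → 0# ≤ n · 1#
  0≤n·1 zero    = ≤-refl
  0≤n·1 (suc n) = +-nonNeg 0≤1 (0≤n·1 n)

  ·1-mono-≤ : ∀ {m n} → m ≤ℕ n → m · 1# ≤ n · 1#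
  ·1-mono-≤ {n = n} z≤n = 0≤n·1 n
  ·1-mono-≤ (s≤s m≤n)   = +-monoʳ-≤ 1# (·1-mono-≤ m≤n)

  x-y≤z⇒x≤z+y : ∀ {x y z} → x - y ≤ z → x ≤ z + y
  x-y≤z⇒x≤z+y {x} {y} = ≤-respˡ (x-y+y≈x x y) ∘ +-monoˡ-≤ y

  <-≤-trans : ∀ {x y z} → x < y → y ≤ z → x < z
  <-≤-trans {z = z} x<y y≤z with #-cotrans (<⇒# x<y) z
  ... | inj₁ x#z = [ id , (λ z<x → ⊥-elim (y≤z (<-trans z<x x<y))) ] (#⇒<⊎> x#z)
  ... | inj₂ z#y = [ ⊥-elim ∘ y≤z , <-trans x<y ] (#⇒<⊎> z#y)

  -- This is `x * (1# - e) ≤ y * (1# - e)` with the subtractions cleared.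
  x≤y⇒x+ye≤y+xe : ∀ {x y e} → e ≤ 1# → x ≤ y → x + y * e ≤ y + x * e
  x≤y⇒x+ye≤y+xe {x} {y} {e} e≤1 x≤y = begin
    x + y * e           ≈⟨ +-congˡ (*-congʳ x+δ≈y) ⟨
    x + (x + δ) * e     ≈⟨ solve 3 (λ x δ e → x :+ (x :+ δ) :* e := x :+ x :* e :+ δ :* e) refl x δ e ⟩
    x + x * e + δ * e   ∼⟨ +-monoʳ-≤ _ (*-monoʳ-≤ δ 0≤δ e≤1) ⟩
    x + x * e + δ * 1#  ≈⟨ solve 3 (λ x δ e → x :+ x :* e :+ δ :* con 1 := x :+ δ :+ x :* e) refl x δ e ⟩
    x + δ + x * e       ≈⟨ +-congʳ x+δ≈y ⟩
    y + x * e           ∎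
    where
    δ = y - x
    x+δ≈y : x + δ ≈ y
    x+δ≈y = trans (+-comm x δ) (x-y+y≈x y x)
    0≤δ : 0# ≤ δ
    0≤δ = ≤-respˡ (-‿inverseʳ x) (+-monoˡ-≤ (- x) x≤y)

-- Finite weighted sums and indicators.

module WeightedSums {c ℓ₁ ℓ₂} (ℝ : RealNumbers c ℓ₁ ℓ₂) where
  open BooleanComplexity ℝ
  open OrderedField ℝ
  open NaturalSolver commutativeSemiring using (solve; con; _:+_; _:*_; _:=_)

  χ : ∀ {a} {A : Set a} → Dec A → Carrier
  χ = bit ∘ does

  0≤χ : ∀ {a} {A : Set a} (A? : Dec A) → 0# ≤ χ A?
  0≤χ (yes _) = 0≤1
  0≤χ (no  _) = ≤-refl

  χ≤1 : ∀ {a} {A : Set a} (A? : Dec A) → χ A? ≤ 1#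
  χ≤1 (yes _) = ≤-refl
  χ≤1 (no  _) = 0≤1

  χ-mono : ∀ {a b} {A : Set a} {B : Set b} → (A → B) → (A? : Dec A) (B? : Dec B) → χ A? ≤ χ B?
  χ-mono A⇒B (no  _) B?      = 0≤χ B?
  χ-mono A⇒B (yes _) (yes _) = ≤-refl
  χ-mono A⇒B (yes a) (no ¬b) = ⊥-elim (¬b (A⇒B a))

  private
    variable
      a b : Level
      A : Set a
      B : Set b

  -- The integral of `h` against the measure on `xs` with density `w`. It serves both for blocks
  -- weighted by a packing and for assignments weighted by a polynomial.
  ⟪_,_⟫ : List A → (A → Carrier) → (A → Carrier) → Carrier
  ⟪ xs , w ⟫ h = ∑ xs λ x → w x * h x

  NonNegOn : List A → (A → Carrier) → Set _
  NonNegOn xs w = All (λ x → 0# ≤ w x) xs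

  ∑-cong : ∀ (xs : List A) {g h} → (∀ x → g x ≈ h x) → ∑ xs g ≈ ∑ xs h
  ∑-cong []       g≈h = refl
  ∑-cong (x ∷ xs) g≈h = +-cong (g≈h x) (∑-cong xs g≈h)

  ∑-filter : ∀ {p} {P : Pred A p} (P? : Decidable P) xs {w : A → Carrier} →
             ∑ (filter P? xs) w ≈ ⟪ xs , w ⟫ (χ ∘ P?)
  ∑-filter P? []       = refl
  ∑-filter P? (x ∷ xs) {w} with P? x
  ... | yes _ = +-cong (sym (*-identityʳ (w x))) (∑-filter P? xs)
  ... | no  _ = trans (∑-filter P? xs) (trans (sym (+-identityˡ _)) (+-congʳ (sym (zeroʳ (w x)))))

  module _ (xs : List A) (w : A → Carrier) where

    wsum-cong : ∀ {g h} → (∀ x → g x ≈ h x) → ⟪ xs , w ⟫ g ≈ ⟪ xs , w ⟫ h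
    wsum-cong g≈h = ∑-cong xs (λ x → *-congˡ (g≈h x))

  wsum-mono : ∀ {xs : List A} {w} {g h} → NonNegOn xs w → All (λ x → g x ≤ h x) xs →
              ⟪ xs , w ⟫ g ≤ ⟪ xs , w ⟫ h
  wsum-mono []         []           = ≤-refl
  wsum-mono (0≤w ∷ ws) (g≤h ∷ gs≤hs) = +-mono-≤ (*-monoʳ-≤ _ 0≤w g≤h) (wsum-mono ws gs≤hs)

  wsum-nonNeg : ∀ {xs : List A} {w} {g} → NonNegOn xs w → (∀ x → 0# ≤ g x) → 0# ≤ ⟪ xs , w ⟫ g
  wsum-nonNeg []        0≤g = ≤-refl
  wsum-nonNeg {xs = x ∷ _} (0≤w ∷ ws) 0≤g = +-nonNeg (*-nonNeg 0≤w (0≤g x)) (wsum-nonNeg ws 0≤g)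

  wsum-+ : ∀ (xs : List A) w g h → ⟪ xs , w ⟫ (λ x → g x + h x) ≈ ⟪ xs , w ⟫ g + ⟪ xs , w ⟫ h
  wsum-+ []       w g h = sym (+-identityˡ 0#)
  wsum-+ (x ∷ xs) w g h = trans (+-congˡ (wsum-+ xs w g h))
    (solve 5 (λ w g h G H → w :* (g :+ h) :+ (G :+ H) := (w :* g :+ G) :+ (w :* h :+ H)) refl
      (w x) (g x) (h x) (⟪ xs , w ⟫ g) (⟪ xs , w ⟫ h))

  wsum-*ˡ : ∀ (xs : List A) w k g → ⟪ xs , w ⟫ (λ x → k * g x) ≈ k * ⟪ xs , w ⟫ g
  wsum-*ˡ []       w k g = sym (zeroʳ k)
  wsum-*ˡ (x ∷ xs) w k g = trans (+-congˡ (wsum-*ˡ xs w k g))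
    (solve 4 (λ w k g G → w :* (k :* g) :+ k :* G := k :* (w :* g :+ G)) refl
      (w x) k (g x) (⟪ xs , w ⟫ g))

  wsum-const : ∀ (xs : List A) w k → ⟪ xs , w ⟫ (λ _ → k) ≈ ∑ xs w * k
  wsum-const []       w k = sym (zeroˡ k)
  wsum-const (x ∷ xs) w k = trans (+-congˡ (wsum-const xs w k)) (sym (distribʳ k (w x) (∑ xs w)))

  -- Fubini for finite sums. Both the double counting of blocks against assignments and the exchange
  -- of the two blocks of a pair rest on it.
  wsum-swap : ∀ (xs : List A) v (ys : List B) w (F : A → B → Carrier) →
              ⟪ xs , v ⟫ (λ x → ⟪ ys , w ⟫ (F x)) ≈ ⟪ ys , w ⟫ (λ y → ⟪ xs , v ⟫ (λ x → F x y))
  wsum-swap []       v ys w F =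
    sym (trans (wsum-const ys w 0#) (zeroʳ _))
  wsum-swap (x ∷ xs) v ys w F =
    trans (+-cong (sym (wsum-*ˡ ys w (v x) (F x))) (wsum-swap xs v ys w F))
          (sym (wsum-+ ys w (λ y → v x * F x y) (λ y → ⟪ xs , v ⟫ λ x → F x y)))

  monomial≈χ : ∀ {n} (p : PartialAssignment n) x → monomial p x ≈ χ (p ⊆? x)
  monomial≈χ []                []          = refl
  monomial≈χ (nothing    ∷ p) (_     ∷ x) = trans (*-identityˡ _) (monomial≈χ p x)
  monomial≈χ (just true  ∷ p) (true  ∷ x) = trans (*-identityˡ _) (monomial≈χ p x)
  monomial≈χ (just true  ∷ p) (false ∷ x) = zeroˡ _
  monomial≈χ (just false ∷ p) (true  ∷ x) = trans (*-congʳ (-‿inverseʳ 1#)) (zeroˡ _)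
  monomial≈χ (just false ∷ p) (false ∷ x) =
    trans (*-congʳ 1-0≈1) (trans (*-identityˡ _) (monomial≈χ p x))
    where
    1-0≈1 : 1# - 0# ≈ 1#
    1-0≈1 = trans (sym (+-identityʳ _)) (x-y+y≈x 1# 0#)

-- Bounds from one packing at a fixed point.

module PackingBounds {c ℓ₁ ℓ₂} (ℝ : RealNumbers c ℓ₁ ℓ₂) where
  open BooleanComplexity ℝ
  open OrderedField ℝ
  open WeightedSums ℝ
  open NaturalSolver commutativeSemiring using (solve; con; _:+_; _:*_; _:=_)
  open ≤-Reasoning

  module _ {n} (q : NonNegPolynomial n) {ε d : Carrier} (0≤ε : 0# ≤ ε) (ε≤1 : ε ≤ 1#)
    (degreeAt≤d : ∀ y → degreeAt q y ≤ d) (f : BooleanFunction n) (approx : Approximates ε q f)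
    (x : Vec Bool n) (bs : List (Subset n)) (a : Subset n → Carrier)
    (a≥0 : NonNegOn bs a) (sensitive : All (Sensitive f x) bs)
    (packing : ∀ i → ∑ (filter (i ∈?_) bs) a ≤ 1#)
    where

    ⟨_⟩ : (Subset n → Carrier) → Carrier
    ⟨_⟩ = ⟪ bs , a ⟫

    P : List (PartialAssignment n)
    P = partialAssignments n

    ⟦_⟧ : (PartialAssignment n → Carrier) → Carrier
    ⟦_⟧ = ⟪ P , weight q ⟫

    w≥0 : NonNegOn P (weight q)
    w≥0 = All.universal (weight≥0 q) P

    s : Carrier
    s = ∑ bs a

    0≤s : 0# ≤ s
    0≤s = ≤-respʳ (trans (wsum-const bs a 1#) (*-identityʳ s)) (wsum-nonNeg a≥0 (λ _ → 0≤1))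

    degree : PartialAssignment n → Carrier
    degree p = ∣ p ∣ · 1#

    χ[_^_] : PartialAssignment n → Subset n → Carrier
    χ[ p ^ B ] = χ (p ⊆? x ^ B)

    τ : PartialAssignment n → Subset n → Subset n → Carrier
    τ p B C = χ (touches? p B C)

    eval≈ : ∀ y → eval q y ≈ ⟦ (λ p → χ (p ⊆? y)) ⟧
    eval≈ y = wsum-cong P (weight q) (λ p → monomial≈χ p y)

    degreeAt≈ : ∀ y → degreeAt q y ≈ ⟦ (λ p → χ (p ⊆? y) * degree p) ⟧
    degreeAt≈ y = trans (∑-filter (_⊆? y) P) (∑-cong P λ p →
      solve 3 (λ w k h → w :* k :* h := w :* (h :* k)) refl (weight q p) (degree p) (χ (p ⊆? y)))

    -- Where `f` is false this follows from `ε ≤ 1#`. It is thus available at `x ^ (B ∪ C)`, where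
    -- the value of `f` is not known.
    eval≤1 : ∀ y → eval q y ≤ 1#
    eval≤1 y with f y in fy
    ... | false = ≤-trans (proj₂ (proj₁ (approx y) fy)) ε≤1
    ... | true  = proj₂ (proj₂ (approx y) fy)

    true⇒1≤eval+ε : ∀ y → f y ≡ true → 1# ≤ eval q y + ε
    true⇒1≤eval+ε y fy = x-y≤z⇒x≤z+y (proj₁ (proj₂ (approx y) fy))

    false⇒eval≤ε : ∀ y → f y ≡ false → eval q y ≤ ε
    false⇒eval≤ε y fy = proj₂ (proj₁ (approx y) fy)

    ⟨∈⟩≤1 : ∀ i → ⟨ (λ C → χ (i ∈? C)) ⟩ ≤ 1#
    ⟨∈⟩≤1 i = ≤-respˡ (∑-filter (i ∈?_) bs) (packing i)

    -- Union bound: the blocks through any one listed coordinate weigh at most 1.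
    ⟨any∈⟩≤length : ∀ is → ⟨ (λ C → χ (Any.any? (_∈? C) is)) ⟩ ≤ length is · 1#
    ⟨any∈⟩≤length []       = ≤-reflexive (trans (wsum-const bs a 0#) (zeroʳ s))
    ⟨any∈⟩≤length (i ∷ is) = begin
      ⟨ (λ C → χ (Any.any? (_∈? C) (i ∷ is))) ⟩                    ∼⟨ wsum-mono a≥0 (All.universal union bs) ⟩
      ⟨ (λ C → χ (i ∈? C) + χ (Any.any? (_∈? C) is)) ⟩             ≈⟨ wsum-+ bs a _ _ ⟩
      ⟨ (λ C → χ (i ∈? C)) ⟩ + ⟨ (λ C → χ (Any.any? (_∈? C) is)) ⟩ ∼⟨ +-mono-≤ (⟨∈⟩≤1 i) (⟨any∈⟩≤length is) ⟩
      1# + length is · 1# ∎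
      where
      union : ∀ C → χ (Any.any? (_∈? C) (i ∷ is)) ≤ χ (i ∈? C) + χ (Any.any? (_∈? C) is)
      union C with i ∈? C
      ... | yes _ = x≤x+y 1# (0≤χ (Any.any? (_∈? C) is))
      ... | no  _ = ≤-reflexive (sym (+-identityˡ _))

    ⟨τ⟩≤degree : ∀ p B → ⟨ τ p B ⟩ ≤ degree p
    ⟨τ⟩≤degree p B = ≤-trans (⟨any∈⟩≤length (supportOutside p B)) (·1-mono-≤ (length-supportOutside p B))

    -- Points where `f` is true.

    module AtTrue (fx : f x ≡ true) where

      -- A `p ⊆ x` that fixes no coordinate in `B` survives flipping `B`. The excluded set `∅` makes
      -- `τ` test plain intersection with `B`.
      χ≤ : ∀ B p → χ (p ⊆? x) ≤ χ[ p ^ B ] + χ (p ⊆? x) * τ p ∅ B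
      χ≤ B p with p ⊆? x | p ⊆? x ^ B | touches? p ∅ B
      ... | no  _   | d     | t      = +-nonNeg (0≤χ d) (*-nonNeg ≤-refl (0≤χ t))
      ... | yes _   | yes _ | t      = x≤x+y 1# (*-nonNeg 0≤1 (0≤χ t))
      ... | yes _   | no  _ | yes _  = ≤-reflexive (solve 0 (con 1 := con 0 :+ con 1 :* con 1) refl)
      ... | yes p⊆x | no p⊈ | no ¬t  = ⊥-elim (p⊈ (≡.subst (λ C → p ⊆ x ^ C) (∪-identityˡ B)
        (⊆-^∪ˡ p x ∅ B (≡.subst (p ⊆_) (≡.sym (^-∅ x)) p⊆x) ¬t)))

      touched : Subset n → Carrier
      touched B = ⟦ (λ p → χ (p ⊆? x) * τ p ∅ B) ⟧

      -- Flipping `B` takes `q` from at least `1# - ε` to at most `ε`, and only assignments counted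
      -- in `touched B` can account for the drop.
      1≤touched : ∀ {B} → Sensitive f x B → 1# ≤ touched B + (ε + ε)
      1≤touched {B} sB = begin
        1#                          ∼⟨ true⇒1≤eval+ε x fx ⟩
        eval q x + ε                ≈⟨ +-congʳ (eval≈ x) ⟩
        ⟦ (λ p → χ (p ⊆? x)) ⟧ + ε  ∼⟨ +-monoˡ-≤ ε (wsum-mono w≥0 (All.universal (χ≤ B) P)) ⟩
        ⟦ (λ p → χ[ p ^ B ] + χ (p ⊆? x) * τ p ∅ B) ⟧ + ε
          ≈⟨ +-congʳ (trans (wsum-+ P (weight q) _ _) (+-congʳ (sym (eval≈ (x ^ B))))) ⟩
        eval q (x ^ B) + touched B + ε
          ∼⟨ +-monoˡ-≤ ε (+-monoˡ-≤ (touched B) (false⇒eval≤ε (x ^ B)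
               (Bool.¬-not (λ fxB → sB (≡.trans fxB (≡.sym fx)))))) ⟩
        ε + touched B + ε           ≈⟨ solve 2 (λ e t → e :+ t :+ e := t :+ (e :+ e)) refl ε (touched B) ⟩
        touched B + (ε + ε)         ∎

      -- Double counting: the blocks touched by a single `p` weigh at most `∣ p ∣`, so exchanging
      -- the sums produces the degree at `x`.
      ⟨touched⟩≤d : ⟨ touched ⟩ ≤ d
      ⟨touched⟩≤d = begin
        ⟨ touched ⟩ ≈⟨ wsum-swap bs a P (weight q) _ ⟩
        ⟦ (λ p → ⟨ (λ B → χ (p ⊆? x) * τ p ∅ B) ⟩) ⟧ ≈⟨ wsum-cong P (weight q) (λ p → wsum-*ˡ bs a _ _) ⟩
        ⟦ (λ p → χ (p ⊆? x) * ⟨ τ p ∅ ⟩) ⟧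
          ∼⟨ wsum-mono w≥0 (All.universal (λ p → *-monoʳ-≤ _ (0≤χ (p ⊆? x)) (⟨τ⟩≤degree p ∅)) P) ⟩
        ⟦ (λ p → χ (p ⊆? x) * degree p) ⟧ ≈⟨ degreeAt≈ x ⟨
        degreeAt q x ∼⟨ degreeAt≤d x ⟩
        d ∎

      s≤d+2εs : s ≤ d + s * (ε + ε)
      s≤d+2εs = begin
        s                               ≈⟨ trans (wsum-const bs a 1#) (*-identityʳ s) ⟨
        ⟨ (λ _ → 1#) ⟩                  ∼⟨ wsum-mono a≥0 (All.map 1≤touched sensitive) ⟩
        ⟨ (λ B → touched B + (ε + ε)) ⟩ ≈⟨ trans (wsum-+ bs a _ _) (+-congˡ (wsum-const bs a _)) ⟩
        ⟨ touched ⟩ + s * (ε + ε)       ∼⟨ +-monoˡ-≤ _ ⟨touched⟩≤d ⟩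
        d + s * (ε + ε)                 ∎

      bound : 1# ≤ s → s + 1# ≤ 2 · d + s * (4 · ε)
      bound 1≤s = begin
        -- The estimate `s≤d+2εs` is used twice; `1# ≤ s` lets a second copy of `s` replace the
        -- `1#`.
        s + 1#                                  ∼⟨ +-monoʳ-≤ s 1≤s ⟩
        s + s                                   ∼⟨ +-mono-≤ s≤d+2εs s≤d+2εs ⟩
        d + s * (ε + ε) + (d + s * (ε + ε))
          ≈⟨ solve 3 (λ d s e → d :+ s :* (e :+ e) :+ (d :+ s :* (e :+ e)) :=
               d :+ (d :+ con 0) :+ s :* (e :+ (e :+ (e :+ (e :+ con 0))))) refl d s ε ⟩
        2 · d + s * (4 · ε) ∎

    -- Points where `f` is false.

    module AtFalse (fx : f x ≡ false) where

      G H : Subset n → Subset n → Carrier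
      G B C = ⟦ (λ p → χ[ p ^ B ] * τ p B C) ⟧
      H B C = ⟦ (λ p → χ[ p ^ B ] * χ[ p ^ C ]) ⟧

      -- A `p` agreeing with exactly one of the two points survives at `x ^ (B ∪ C)` or touches the
      -- other block outside its own. One agreeing with both also agrees with `x ^ (B ∪ C)`, and the
      -- product term supplies the second unit.
      χ+χ≤ : ∀ B C p → χ[ p ^ B ] + χ[ p ^ C ] ≤
        χ[ p ^ (B ∪ C) ] + (χ[ p ^ B ] * τ p B C + (χ[ p ^ C ] * τ p C B + χ[ p ^ B ] * χ[ p ^ C ]))
      χ+χ≤ B C p with p ⊆? x ^ B | p ⊆? x ^ C | p ⊆? x ^ (B ∪ C) | touches? p B C | touches? p C B
      ... | no  _   | no  _   | u      | t     | t′     =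
        ≤-respˡ (sym (+-identityˡ 0#)) (+-nonNeg (0≤χ u) (+-nonNeg (*-nonNeg ≤-refl (0≤χ t))
          (+-nonNeg (*-nonNeg ≤-refl (0≤χ t′)) (*-nonNeg ≤-refl ≤-refl))))
      ... | yes _   | no  _   | yes _  | t     | t′     = ≤-respˡ (sym (+-identityʳ 1#)) (x≤x+y 1#
        (+-nonNeg (*-nonNeg 0≤1 (0≤χ t)) (+-nonNeg (*-nonNeg ≤-refl (0≤χ t′)) (*-nonNeg 0≤1 ≤-refl))))
      ... | yes _   | no  _   | no  _  | yes _ | t′     = ≤-reflexive
        (solve 1 (λ t → con 1 :+ con 0 := con 0 :+ (con 1 :* con 1 :+ (con 0 :* t :+ con 1 :* con 0))) refl (χ t′))
      ... | yes p⊆B | no  _   | no p⊈  | no ¬t | _      = ⊥-elim (p⊈ (⊆-^∪ˡ p x B C p⊆B ¬t))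
      ... | no  _   | yes _   | yes _  | t     | t′     = ≤-respˡ (sym (+-identityˡ 1#)) (x≤x+y 1#
        (+-nonNeg (*-nonNeg ≤-refl (0≤χ t)) (+-nonNeg (*-nonNeg 0≤1 (0≤χ t′)) (*-nonNeg ≤-refl 0≤1))))
      ... | no  _   | yes _   | no  _  | t     | yes _  = ≤-reflexive
        (solve 1 (λ t → con 0 :+ con 1 := con 0 :+ (con 0 :* t :+ (con 1 :* con 1 :+ con 0 :* con 1))) refl (χ t))
      ... | no  _   | yes p⊆C | no p⊈  | _     | no ¬t′ =
        ⊥-elim (p⊈ (≡.subst (λ D → p ⊆ x ^ D) (∪-comm C B) (⊆-^∪ˡ p x C B p⊆C ¬t′)))
      ... | yes p⊆B | yes p⊆C | no p⊈  | _     | _      = ⊥-elim (p⊈ (⊆-^∪ p x B C p⊆B p⊆C))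
      ... | yes _   | yes _   | yes _  | t     | t′     = +-monoʳ-≤ 1#
        (≤-trans (y≤x+y 1# (+-nonNeg (*-nonNeg 0≤1 (0≤χ t)) (*-nonNeg 0≤1 (0≤χ t′))))
          (≤-reflexive (solve 2 (λ t t′ → con 1 :* t :+ con 1 :* t′ :+ con 1 :=
            con 1 :* t :+ (con 1 :* t′ :+ con 1 :* con 1)) refl (χ t) (χ t′))))

      1≤eval : ∀ {B} → Sensitive f x B → 1# ≤ eval q (x ^ B) + ε
      1≤eval {B} sB = true⇒1≤eval+ε (x ^ B) (Bool.¬-not (λ fxB → sB (≡.trans fxB (≡.sym fx))))

      1≤pair : ∀ {B C} → Sensitive f x B → Sensitive f x C → 1# ≤ G B C + (G C B + H B C) + (ε + ε)
      -- Two evaluations contribute two units, up to `ε + ε`; the evaluation at the union absorbs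
      -- one of them.
      1≤pair {B} {C} sB sC = +-cancelʳ-≤ 1# (begin
        1# + 1#                                       ∼⟨ +-mono-≤ (1≤eval sB) (1≤eval sC) ⟩
        eval q (x ^ B) + ε + (eval q (x ^ C) + ε)
          ≈⟨ +-cong (+-congʳ (eval≈ (x ^ B))) (+-congʳ (eval≈ (x ^ C))) ⟩
        ⟦ (λ p → χ[ p ^ B ]) ⟧ + ε + (⟦ (λ p → χ[ p ^ C ]) ⟧ + ε)
          ≈⟨ solve 3 (λ b c e → b :+ e :+ (c :+ e) := b :+ c :+ (e :+ e)) refl _ _ ε ⟩
        ⟦ (λ p → χ[ p ^ B ]) ⟧ + ⟦ (λ p → χ[ p ^ C ]) ⟧ + (ε + ε)
          ≈⟨ +-congʳ (wsum-+ P (weight q) _ _) ⟨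
        ⟦ (λ p → χ[ p ^ B ] + χ[ p ^ C ]) ⟧ + (ε + ε)
          ∼⟨ +-monoˡ-≤ _ (wsum-mono w≥0 (All.universal (χ+χ≤ B C) P)) ⟩
        ⟦ (λ p → χ[ p ^ (B ∪ C) ] +
             (χ[ p ^ B ] * τ p B C + (χ[ p ^ C ] * τ p C B + χ[ p ^ B ] * χ[ p ^ C ]))) ⟧ + (ε + ε)
          ≈⟨ +-congʳ (trans (wsum-+ P (weight q) _ _) (+-cong (sym (eval≈ (x ^ (B ∪ C))))
               (trans (wsum-+ P (weight q) _ _) (+-congˡ (wsum-+ P (weight q) _ _))))) ⟩
        eval q (x ^ (B ∪ C)) + (G B C + (G C B + H B C)) + (ε + ε)
          ∼⟨ +-monoˡ-≤ _ (+-monoˡ-≤ _ (eval≤1 (x ^ (B ∪ C)))) ⟩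
        1# + (G B C + (G C B + H B C)) + (ε + ε)
          ≈⟨ solve 2 (λ g e → con 1 :+ g :+ e := g :+ e :+ con 1) refl _ (ε + ε) ⟩
        G B C + (G C B + H B C) + (ε + ε) + 1# ∎)

      -- If `p ⊆ x`, the intersection term is at most `s`, and the excess `s + 1#` is charged to the
      -- weight of such `p`, whose total `eval q x` is at most `ε`.
      χ⟨⟩≤ : ∀ B p → χ[ p ^ B ] * ⟨ (λ C → τ p B C + (τ p B C + χ[ p ^ C ])) ⟩ + χ[ p ^ B ] ≤
             χ[ p ^ B ] * degree p + χ[ p ^ B ] * degree p + χ (p ⊆? x) * (s + 1#)
      χ⟨⟩≤ B p with p ⊆? x ^ B | p ⊆? x
      ... | no  _   | e       = ≤-respˡ
        (solve 2 (λ m k → con 0 :* k :+ con 0 :* k := con 0 :* m :+ con 0) refl _ (degree p))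
        (x≤x+y _ (*-nonNeg (0≤χ e) (+-nonNeg 0≤s 0≤1)))
      ... | yes p⊆B | yes _   = begin
        1# * ⟨ (λ C → τ p B C + (τ p B C + χ[ p ^ C ])) ⟩ + 1#
          ≈⟨ +-congʳ (*-congˡ (trans (wsum-+ bs a _ _) (+-congˡ (wsum-+ bs a _ _)))) ⟩
        1# * (⟨ τ p B ⟩ + (⟨ τ p B ⟩ + ⟨ (λ C → χ[ p ^ C ]) ⟩)) + 1#
          ∼⟨ +-monoˡ-≤ 1# (*-monoʳ-≤ 1# 0≤1 (+-mono-≤ (⟨τ⟩≤degree p B) (+-mono-≤ (⟨τ⟩≤degree p B)
               (wsum-mono a≥0 (All.universal (λ C → χ≤1 (p ⊆? x ^ C)) bs))))) ⟩
        1# * (degree p + (degree p + ⟨ (λ _ → 1#) ⟩)) + 1#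
          ≈⟨ +-congʳ (*-congˡ (+-congˡ (+-congˡ (trans (wsum-const bs a 1#) (*-identityʳ s))))) ⟩
        1# * (degree p + (degree p + s)) + 1#
          ≈⟨ solve 2 (λ k s → con 1 :* (k :+ (k :+ s)) :+ con 1 :=
               con 1 :* k :+ con 1 :* k :+ con 1 :* (s :+ con 1)) refl (degree p) s ⟩
        1# * degree p + 1# * degree p + 1# * (s + 1#) ∎
      -- Every `C` with `p ⊆ x ^ C` contains the conflict `i`, so these blocks weigh at most 1
      -- together. As `i` also lies in `B`, it is missing from `supportOutside p B`, and two copies
      -- of `1+⟨τ⟩≤degree` cover both units.
      ... | yes p⊆B | no  p⊈x = let i , pᵢ = ⊈⇒conflict p x p⊈x in begin
        1# * ⟨ (λ C → τ p B C + (τ p B C + χ[ p ^ C ])) ⟩ + 1#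
          ≈⟨ +-congʳ (*-congˡ (trans (wsum-+ bs a _ _) (+-congˡ (wsum-+ bs a _ _)))) ⟩
        1# * (⟨ τ p B ⟩ + (⟨ τ p B ⟩ + ⟨ (λ C → χ[ p ^ C ]) ⟩)) + 1#
          ∼⟨ +-monoˡ-≤ 1# (*-monoʳ-≤ 1# 0≤1 (+-monoʳ-≤ _ (+-monoʳ-≤ _ (≤-trans (wsum-mono a≥0
               (All.universal (λ C → χ-mono (conflict⇒∈ p x C i pᵢ) (p ⊆? x ^ C) (i ∈? C)) bs)) (⟨∈⟩≤1 i))))) ⟩
        1# * (⟨ τ p B ⟩ + (⟨ τ p B ⟩ + 1#)) + 1#
          ≈⟨ solve 1 (λ t → con 1 :* (t :+ (t :+ con 1)) :+ con 1 := con 1 :+ t :+ (con 1 :+ t)) refl ⟨ τ p B ⟩ ⟩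
        1# + ⟨ τ p B ⟩ + (1# + ⟨ τ p B ⟩)
          ∼⟨ +-mono-≤ (1+⟨τ⟩≤degree pᵢ) (1+⟨τ⟩≤degree pᵢ) ⟩
        degree p + degree p
          ≈⟨ solve 2 (λ k s → k :+ k := con 1 :* k :+ con 1 :* k :+ con 0 :* (s :+ con 1)) refl (degree p) s ⟩
        1# * degree p + 1# * degree p + 0# * (s + 1#) ∎
        where
        1+⟨τ⟩≤degree : ∀ {i} → lookup p i ≡ just (not (lookup x i)) → 1# + ⟨ τ p B ⟩ ≤ degree p
        1+⟨τ⟩≤degree {i} pᵢ = ≤-trans (+-monoʳ-≤ 1# (⟨any∈⟩≤length (supportOutside p B)))
          (·1-mono-≤ (length-supportOutside-< p pᵢ (conflict⇒∈ p x B i pᵢ p⊆B)))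

      -- With `G B C` in place of the `G C B` of `1≤pair`, every term ranges over `p ⊆ x ^ B` and is
      -- controlled by the degree at `x ^ B`.
      K : Subset n → Carrier
      K B = ⟨ (λ C → G B C + (G B C + H B C)) ⟩

      K≈ : ∀ B → K B ≈ ⟦ (λ p → χ[ p ^ B ] * ⟨ (λ C → τ p B C + (τ p B C + χ[ p ^ C ])) ⟩) ⟧
      K≈ B = trans (wsum-cong bs a λ C → sym (trans (wsum-cong P (weight q) λ p →
                 solve 3 (λ b t c → b :* (t :+ (t :+ c)) := b :* t :+ (b :* t :+ b :* c)) refl
                   χ[ p ^ B ] (τ p B C) χ[ p ^ C ])
               (trans (wsum-+ P (weight q) _ _) (+-congˡ (wsum-+ P (weight q) _ _)))))
             (trans (wsum-swap bs a P (weight q) _) (wsum-cong P (weight q) λ p → wsum-*ˡ bs a _ _))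

      K≤ : ∀ {B} → Sensitive f x B → K B + 1# ≤ d + d + ε * (s + 1#) + ε
      K≤ {B} sB = begin
        -- The `- 1#` of the final bound arises here: up to `ε`, the `1#` is traded for the weight
        -- of all `p ⊆ x ^ B`, matching the extra `χ[ p ^ B ]` in `χ⟨⟩≤`.
        K B + 1#                          ∼⟨ +-monoʳ-≤ (K B) (1≤eval sB) ⟩
        K B + (eval q (x ^ B) + ε)        ≈⟨ +-assoc (K B) _ ε ⟨
        K B + eval q (x ^ B) + ε          ≈⟨ +-congʳ (+-cong (K≈ B) (eval≈ (x ^ B))) ⟩
        _ + _ + ε                         ≈⟨ +-congʳ (wsum-+ P (weight q) _ _) ⟨
        _ + ε                             ∼⟨ +-monoˡ-≤ ε (wsum-mono w≥0 (All.universal (χ⟨⟩≤ B) P)) ⟩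
        ⟦ (λ p → χ[ p ^ B ] * degree p + χ[ p ^ B ] * degree p + χ (p ⊆? x) * (s + 1#)) ⟧ + ε
          ≈⟨ +-congʳ (trans (wsum-+ P (weight q) _ _) (+-cong
               (trans (wsum-+ P (weight q) _ _) (sym (+-cong (degreeAt≈ (x ^ B)) (degreeAt≈ (x ^ B)))))
               (trans (wsum-cong P (weight q) (λ p → *-comm _ _)) (trans (wsum-*ˡ P (weight q) _ _)
                 (trans (*-comm _ _) (*-congʳ (sym (eval≈ x)))))))) ⟩
        degreeAt q (x ^ B) + degreeAt q (x ^ B) + eval q x * (s + 1#) + ε
          ∼⟨ +-monoˡ-≤ ε (+-mono-≤ (+-mono-≤ (degreeAt≤d (x ^ B)) (degreeAt≤d (x ^ B)))
               (≤-respˡ (*-comm _ _) (≤-respʳ (*-comm _ _)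
                 (*-monoʳ-≤ (s + 1#) (+-nonNeg 0≤s 0≤1) (false⇒eval≤ε x fx))))) ⟩
        d + d + ε * (s + 1#) + ε          ∎

      -- Exchanging B and C in one of the three double sums turns G C B into G B C.
      s²≤⟨K⟩ : s * s ≤ ⟨ K ⟩ + s * (s * (ε + ε))
      s²≤⟨K⟩ = begin
        s * s                                      ≈⟨ *-congˡ (trans (wsum-const bs a 1#) (*-identityʳ s)) ⟨
        s * ⟨ (λ _ → 1#) ⟩                         ≈⟨ wsum-const bs a _ ⟨
        ⟨ (λ _ → ⟨ (λ _ → 1#) ⟩) ⟩
          ∼⟨ wsum-mono a≥0 (All.map (λ sB → wsum-mono a≥0 (All.map (1≤pair sB) sensitive)) sensitive) ⟩
        ⟨ (λ B → ⟨ (λ C → G B C + (G C B + H B C) + (ε + ε)) ⟩) ⟩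
          ≈⟨ wsum-cong bs a (λ B → trans (wsum-+ bs a _ _) (+-cong
               (trans (wsum-+ bs a _ _) (+-congˡ (wsum-+ bs a _ _))) (wsum-const bs a _))) ⟩
        ⟨ (λ B → ⟨ G B ⟩ + (⟨ (λ C → G C B) ⟩ + ⟨ H B ⟩) + s * (ε + ε)) ⟩
          ≈⟨ trans (wsum-+ bs a _ _) (+-cong
               (trans (wsum-+ bs a _ _) (+-congˡ (wsum-+ bs a _ _))) (wsum-const bs a _)) ⟩
        ⟨ (λ B → ⟨ G B ⟩) ⟩ + (⟨ (λ B → ⟨ (λ C → G C B) ⟩) ⟩ + ⟨ (λ B → ⟨ H B ⟩) ⟩) + s * (s * (ε + ε))
          ≈⟨ +-congʳ (+-congˡ (+-congʳ (wsum-swap bs a bs a _))) ⟩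
        ⟨ (λ B → ⟨ G B ⟩) ⟩ + (⟨ (λ B → ⟨ G B ⟩) ⟩ + ⟨ (λ B → ⟨ H B ⟩) ⟩) + s * (s * (ε + ε))
          ≈⟨ +-congʳ (sym (trans (wsum-cong bs a (λ B → trans (wsum-+ bs a _ _) (+-congˡ (wsum-+ bs a _ _))))
               (trans (wsum-+ bs a _ _) (+-congˡ (wsum-+ bs a _ _))))) ⟩
        ⟨ K ⟩ + s * (s * (ε + ε)) ∎

      quadratic : s * (s + 1#) ≤ s * (d + d + ε * (s + 1#) + ε + s * (ε + ε))
      quadratic = begin
        s * (s + 1#)                                ≈⟨ distribˡ s s 1# ⟩
        s * s + s * 1#                              ∼⟨ +-monoˡ-≤ _ s²≤⟨K⟩ ⟩
        ⟨ K ⟩ + s * (s * (ε + ε)) + s * 1#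
          ≈⟨ solve 3 (λ k m n → k :+ m :+ n := k :+ n :+ m) refl ⟨ K ⟩ _ _ ⟩
        ⟨ K ⟩ + s * 1# + s * (s * (ε + ε))          ≈⟨ +-congʳ (+-congˡ (wsum-const bs a 1#)) ⟨
        ⟨ K ⟩ + ⟨ (λ _ → 1#) ⟩ + s * (s * (ε + ε))  ≈⟨ +-congʳ (wsum-+ bs a K _) ⟨
        ⟨ (λ B → K B + 1#) ⟩ + s * (s * (ε + ε))    ∼⟨ +-monoˡ-≤ _ (wsum-mono a≥0 (All.map K≤ sensitive)) ⟩
        ⟨ (λ _ → d + d + ε * (s + 1#) + ε) ⟩ + s * (s * (ε + ε)) ≈⟨ +-congʳ (wsum-const bs a _) ⟩
        s * (d + d + ε * (s + 1#) + ε) + s * (s * (ε + ε))       ≈⟨ distribˡ s _ _ ⟨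
        s * (d + d + ε * (s + 1#) + ε + s * (ε + ε)) ∎

      bound : 0# < s → 2 · 1# ≤ s → s + 1# ≤ 2 · d + s * (4 · ε)
      bound 0<s 2≤s = begin
        s + 1#                                    ∼⟨ *-cancelˡ-≤ s 0<s quadratic ⟩
        d + d + ε * (s + 1#) + ε + s * (ε + ε)
          ≈⟨ solve 3 (λ d s e → d :+ d :+ e :* (s :+ con 1) :+ e :+ s :* (e :+ e) :=
               d :+ (d :+ con 0) :+ s :* (e :+ (e :+ e)) :+ e :* (con 1 :+ (con 1 :+ con 0))) refl d s ε ⟩
        -- The leftover error `ε * 2 · 1#` does not scale with `s`; `2≤s` absorbs it as the fourth
        -- multiple of `s * ε`.
        2 · d + s * (ε + (ε + ε)) + ε * 2 · 1#    ∼⟨ +-monoʳ-≤ _ (*-monoʳ-≤ ε 0≤ε 2≤s) ⟩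
        2 · d + s * (ε + (ε + ε)) + ε * s
          ≈⟨ solve 3 (λ d s e → d :+ s :* (e :+ (e :+ e)) :+ e :* s :=
               d :+ s :* (e :+ (e :+ (e :+ (e :+ con 0))))) refl (2 · d) s ε ⟩
        2 · d + s * (4 · ε) ∎

-- Combining heavy and light packings.

module RCBound {c ℓ₁ ℓ₂} (ℝ : RealNumbers c ℓ₁ ℓ₂) where
  open BooleanComplexity ℝ
  open OrderedField ℝ
  open WeightedSums ℝ
  open PackingBounds ℝ
  open NaturalSolver commutativeSemiring using (solve; con; _:+_; _:*_; _:=_)
  open ≤-Reasoning

  0<2 : 0# < 2 · 1#
  0<2 = <-respˡ-≈ (·0≈0 2) (·-monoʳ-< 1 0<1)

  1≤2 : 1# ≤ 2 · 1#
  1≤2 = ·1-mono-≤ {1} {2} (s≤s z≤n) ∘ <-respʳ-≈ (sym (+-identityʳ 1#))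

  module _ {n} (q : NonNegPolynomial n) {ε d : Carrier} (0≤ε : 0# ≤ ε) (ε<¼ : ε < ¼)
    (degreeAt≤d : ∀ y → degreeAt q y ≤ d) (f : BooleanFunction n) (approx : Approximates ε q f)
    where

    4ε≤1 : 4 · ε ≤ 1#
    4ε≤1 = <⇒≤ (<-respʳ-≈ 4·¼≈1 (·-monoʳ-< 3 ε<¼))

    ε≤1 : ε ≤ 1#
    ε≤1 = ≤-trans (x≤x+y ε (+-nonNeg 0≤ε (+-nonNeg 0≤ε (+-nonNeg 0≤ε ≤-refl)))) 4ε≤1

    -- The inequality `s * (1# - 4 · ε) ≤ 2 · d - 1#` with its subtractions cleared.
    Bounded : Carrier → Set ℓ₂
    Bounded s = s + 1# ≤ 2 · d + s * (4 · ε)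

    -- Since `4 · ε ≤ 1#`, the left side `s * (1# - 4 · ε)` grows with `s`.
    Bounded-antitone : ∀ {r s} → r ≤ s → Bounded s → Bounded r
    Bounded-antitone {r} {s} r≤s bounded = +-cancelʳ-≤ (s * (4 · ε)) (begin
      r + 1# + s * (4 · ε)
        ≈⟨ solve 2 (λ r u → r :+ con 1 :+ u := r :+ u :+ con 1) refl r _ ⟩
      r + s * (4 · ε) + 1#              ∼⟨ +-monoˡ-≤ 1# (x≤y⇒x+ye≤y+xe 4ε≤1 r≤s) ⟩
      s + r * (4 · ε) + 1#
        ≈⟨ solve 2 (λ s v → s :+ v :+ con 1 := s :+ con 1 :+ v) refl s _ ⟩
      s + 1# + r * (4 · ε)              ∼⟨ +-monoˡ-≤ _ bounded ⟩
      2 · d + s * (4 · ε) + r * (4 · ε)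
        ≈⟨ solve 3 (λ d u v → d :+ u :+ v := d :+ v :+ u) refl (2 · d) _ _ ⟩
      2 · d + r * (4 · ε) + s * (4 · ε) ∎)

    bounded-2≤ : ∀ x bs a → NonNegOn bs a → All (Sensitive f x) bs →
                 (∀ i → ∑ (filter (i ∈?_) bs) a ≤ 1#) → 2 · 1# ≤ ∑ bs a → Bounded (∑ bs a)
    bounded-2≤ x bs a a≥0 sens packing 2≤s with f x Bool.≟ true
    ... | yes fx = AtTrue.bound q 0≤ε ε≤1 degreeAt≤d f approx x bs a a≥0 sens packing fx (≤-trans 1≤2 2≤s)
    ... | no ¬fx = AtFalse.bound q 0≤ε ε≤1 degreeAt≤d f approx x bs a a≥0 sens packing
                     (Bool.¬-not ¬fx) (<-≤-trans 0<2 2≤s) 2≤s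

    disjoint⇒bounded-2 : HasDisjointSensitiveBlocks f → Bounded (2 · 1#)
    disjoint⇒bounded-2 (u , i , C , si , sC , i∉C) =
      -- Both `2 · 1#` and the sum over the two blocks unfold to `1# + (1# + 0#)`, hence `≤-refl`.
      bounded-2≤ u (⁅ i ⁆ ∷ C ∷ []) (λ _ → 1#) (0≤1 ∷ 0≤1 ∷ []) (si ∷ sC ∷ []) packing ≤-refl
      where
      packing : ∀ j → ∑ (filter (j ∈?_) (⁅ i ⁆ ∷ C ∷ [])) (λ _ → 1#) ≤ 1#
      packing j with j ∈? ⁅ i ⁆
      packing j | yes j∈i with j ∈? C
      ... | yes j∈C = ⊥-elim (i∉C (≡.subst (_∈ C) (x∈⁅y⁆⇒x≡y i j∈i) j∈C))
      ... | no  _   = ≤-reflexive (+-identityʳ 1#)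
      packing j | no  _ with j ∈? C
      ... | yes _   = ≤-reflexive (+-identityʳ 1#)
      ... | no  _   = 0≤1

    trueEdge⇒bounded-1 : ∀ u i → Sensitive f u ⁅ i ⁆ → f u ≡ true → Bounded (1 · 1#)
    trueEdge⇒bounded-1 u i s fu = AtTrue.bound q 0≤ε ε≤1 degreeAt≤d f approx u (⁅ i ⁆ ∷ [])
      (λ _ → 1#) (0≤1 ∷ []) (s ∷ []) packing fu (x≤x+y 1# ≤-refl)
      where
      packing : ∀ j → ∑ (filter (j ∈?_) (⁅ i ⁆ ∷ [])) (λ _ → 1#) ≤ 1#
      packing j with j ∈? ⁅ i ⁆
      ... | yes _ = ≤-reflexive (+-identityʳ 1#)
      ... | no  _ = 0≤1

    edge⇒bounded-1 : ∀ u i → Sensitive f u ⁅ i ⁆ → Bounded (1 · 1#)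
    edge⇒bounded-1 u i s with f u Bool.≟ true
    ... | yes fu = trueEdge⇒bounded-1 u i s fu
    ... | no ¬fu = trueEdge⇒bounded-1 (u ^ ⁅ i ⁆) i (sensitive-^ f u ⁅ i ⁆ s)
                     (≡.trans (Bool.¬-not s) (≡.cong not (Bool.¬-not ¬fu)))

    packing-bounded : NonConstant f → ∀ x bs a → NonNegOn bs a → All (Sensitive f x) bs →
                      (∀ i → ∑ (filter (i ∈?_) bs) a ≤ 1#) → Bounded (∑ bs a)
    packing-bounded nonConstant x bs a a≥0 sens packing
      with u , i , s ← sensitiveEdge f nonConstant with disjointOrDictator f u i s
    ... | inj₁ disjoint = ≤-by-cases (∑ bs a) (2 · 1#)
      (λ s<2 → Bounded-antitone (<⇒≤ s<2) (disjoint⇒bounded-2 disjoint))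
      (bounded-2≤ x bs a a≥0 sens packing)
    -- All blocks contain `i`, so filtering by `i` keeps the whole list and the constraint at `i`
    -- bounds the total weight by 1.
    ... | inj₂ dictator = Bounded-antitone
      (≤-trans (≡.subst (λ bs′ → ∑ bs′ a ≤ 1#)
        (filter-all (i ∈?_) (All.map (dictator x _) sens)) (packing i)) (x≤x+y 1# ≤-refl))
      (edge⇒bounded-1 u i s)

-- Passing from packings to `RC`.

theorem23 : ∀ {c ℓ₁ ℓ₂} (ℝ : RealNumbers c ℓ₁ ℓ₂) →
    let open BooleanComplexity ℝ in
    (n : ℕ) (f : BooleanFunction n) → NonConstant f →
    (ε : Carrier) → 0# ≤ ε → (ε<¼ : ε < ¼) →
    (rc avdeg : Carrier) → IsRC f rc → IsMinAverageDegree ε f avdeg →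
    rc ≤ (2 · avdeg - 1#) ÷ (1# - 4 · ε) [ 1-4ε#0 ε<¼ ]
theorem23 ℝ n f nonConstant@(y , z , fy≢fz) ε 0≤ε ε<¼ rc avdeg
  ((x , (a , (a≥0 , packing) , rc≈) , _) , _) ((q , approximates , (_ , average)) , _) =
  -- Multiplying by `D` and adding `4 · ε * rc + 1#` clears the quotient and the subtractions,
  -- leaving the inequality for the optimal packing at `x`.
  *-cancelˡ-≤ D (0<1-4ε ε<¼) (≤-respʳ (sym (y*x÷y≈x (2 · avdeg - 1#) D (1-4ε#0 ε<¼)))
    (+-cancelʳ-≤ (4 · ε * rc + 1#) (begin
      D * rc + (4 · ε * rc + 1#)           ≈⟨ +-assoc _ _ 1# ⟨
      D * rc + 4 · ε * rc + 1#             ≈⟨ +-congʳ (distribʳ rc D (4 · ε)) ⟨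
      (D + 4 · ε) * rc + 1#                ≈⟨ +-congʳ (trans (*-congʳ (x-y+y≈x 1# (4 · ε))) (*-identityˡ rc)) ⟩
      rc + 1#                              ≈⟨ +-congʳ rc≈ ⟩
      ∑ bs a + 1#                          ∼⟨ bounded approximates ⟩
      2 · avdeg + ∑ bs a * (4 · ε)         ≈⟨ +-congˡ (trans (*-congʳ (sym rc≈)) (*-comm rc _)) ⟩
      2 · avdeg + 4 · ε * rc               ≈⟨ +-congʳ (x-y+y≈x (2 · avdeg) 1#) ⟨
      2 · avdeg - 1# + 1# + 4 · ε * rc
        ≈⟨ solve 3 (λ m o e → m :+ o :+ e := m :+ (e :+ o)) refl (2 · avdeg - 1#) 1# (4 · ε * rc) ⟩
      2 · avdeg - 1# + (4 · ε * rc + 1#)   ∎)))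
  where
  open BooleanComplexity ℝ
  open OrderedField ℝ
  open WeightedSums ℝ
  open RCBound ℝ
  open NaturalSolver commutativeSemiring using (solve; _:+_; _:=_)
  open ≤-Reasoning

  D = 1# - 4 · ε
  bs = sensitiveBlocks f x

  sens : All (Sensitive f x) bs
  sens = All.all-filter (sensitive? f x) (subsets n)

  bounded : Approximates ε q f ⊎ Approximates ε q (not ∘ f) →
            ∑ bs a + 1# ≤ 2 · avdeg + ∑ bs a * (4 · ε)
  bounded (inj₁ approx) = packing-bounded q 0≤ε ε<¼ (λ y → average (y , refl)) f approx
    nonConstant x bs a (All.map (λ {B} → a≥0 B) sens) sens packing
  -- A function and its negation have the same sensitive blocks, so the packing carries over.
  bounded (inj₂ approx) = packing-bounded q 0≤ε ε<¼ (λ y → average (y , refl)) (not ∘ f) approx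
    (y , z , fy≢fz ∘ Bool.not-injective) x bs a (All.map (λ {B} → a≥0 B) sens)
    (All.map (_∘ Bool.not-injective) sens) packing
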